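{- Let $P, Q \subseteq \mathbb{R}^d$ be rational polytopes such that for every integer vector $w \in \mathbb{Z}^d$ and every real $s > 0$ we have $L_{P + w}(s) = L_{Q + w}(s)$. Then $P = Q$.
   Context: For a polytope $P \subseteq \mathbb{R}^d$ and real $s \ge 0$, the real Ehrhart function is $L_P(s) = \#(sP \cap \mathbb{Z}^d)$, where $sP = \{sx : x \in P\}$. A rational polytope is the convex hull of finitely many points of $\mathbb{Q}^d$. -}

module Defs where

open import Data.Integer.Base using (ℤ)
open import Data.List.Base using (List; length)
open import Data.List.Membership.Propositional using (_∈_)
open import Data.List.Relation.Unary.Unique.Propositional using (Unique)
open import Data.Nat.Base as ℕ using (ℕ; _⊔_)
import Data.Nat.Properties as ℕₚ
open import Data.Product.Base using (∃-syntax; Σ-syntax; _×_; _,_)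
open import Data.Rational.Base as ℚ using (ℚ; 0ℚ; 1ℚ; ½; ∣_∣)
import Data.Rational.Properties as ℚₚ
open import Data.Rational.Solver using (module +-*-Solver)
open import Data.Vec.Base using (Vec; lookup)
open import Data.Vec.Functional using (Vector; foldr)
open import Function.Bundles using (_⇔_)
open import Level using (0ℓ)
open import Relation.Binary.PropositionalEquality
  using (_≡_; refl; sym; trans; cong; cong₂; subst)
open import Relation.Unary using (Pred; _≐_)

IsCauchy : (ℕ → ℚ) → Set
IsCauchy x = ∀ ε → 0ℚ ℚ.< ε →
  ∃[ N ] (∀ m n → N ℕ.≤ m → N ℕ.≤ n → ∣ x m ℚ.- x n ∣ ℚ.< ε)

private abstract

  halves : ∀ ε → ε ℚ.* ½ ℚ.+ ε ℚ.* ½ ≡ ε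
  halves ε = trans (sym (ℚₚ.*-distribˡ-+ ε ½ ½)) (ℚₚ.*-identityʳ ε)

  half-pos : ∀ {ε} → 0ℚ ℚ.< ε → 0ℚ ℚ.< ε ℚ.* ½
  half-pos 0<ε = ℚₚ.*-monoˡ-<-pos ½ 0<ε

  eventuallyBounded : ∀ {x} → IsCauchy x →
    ∃[ B ] (0ℚ ℚ.< B × ∃[ N ] (∀ n → N ℕ.≤ n → ∣ x n ∣ ℚ.≤ B))
  eventuallyBounded {x} c with N , h ← c 1ℚ (ℚₚ.positive⁻¹ 1ℚ) =
    1ℚ ℚ.+ ∣ x N ∣ ,
    ℚₚ.+-mono-<-≤ {0ℚ} {1ℚ} {0ℚ} (ℚₚ.positive⁻¹ 1ℚ) (ℚₚ.0≤∣p∣ (x N)) ,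
    N , bound
    where
    bound : ∀ n → N ℕ.≤ n → ∣ x n ∣ ℚ.≤ 1ℚ ℚ.+ ∣ x N ∣
    bound n N≤n = begin
      ∣ x n ∣                        ≡⟨ cong ∣_∣ (rearrange (x n) (x N)) ⟩
      ∣ (x n ℚ.- x N) ℚ.+ x N ∣      ≤⟨ ℚₚ.∣p+q∣≤∣p∣+∣q∣ (x n ℚ.- x N) (x N) ⟩
      ∣ x n ℚ.- x N ∣ ℚ.+ ∣ x N ∣    ≤⟨ ℚₚ.+-monoˡ-≤ ∣ x N ∣ (ℚₚ.<⇒≤ (h n N N≤n ℕₚ.≤-refl)) ⟩
      1ℚ ℚ.+ ∣ x N ∣                 ∎
      where
      open ℚₚ.≤-Reasoning
      open +-*-Solver
      rearrange : ∀ a b → a ≡ (a ℚ.- b) ℚ.+ b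
      rearrange = solve 2 (λ a b → a := (a :- b) :+ b) refl

  const-cauchy : ∀ q → IsCauchy (λ _ → q)
  const-cauchy q ε 0<ε =
    0 , λ _ _ _ _ → subst (ℚ._< ε) (sym (cong ∣_∣ (ℚₚ.+-inverseʳ q))) 0<ε

  +-cauchy : ∀ {x y} → IsCauchy x → IsCauchy y → IsCauchy (λ n → x n ℚ.+ y n)
  +-cauchy {x} {y} cx cy ε 0<ε
    with M , hx ← cx (ε ℚ.* ½) (half-pos 0<ε)
       | N , hy ← cy (ε ℚ.* ½) (half-pos 0<ε) = M ⊔ N , close
    where
    close : ∀ m n → M ⊔ N ℕ.≤ m → M ⊔ N ℕ.≤ n →
            ∣ (x m ℚ.+ y m) ℚ.- (x n ℚ.+ y n) ∣ ℚ.< ε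
    close m n ≤m ≤n = begin-strict
      ∣ (x m ℚ.+ y m) ℚ.- (x n ℚ.+ y n) ∣  ≡⟨ cong ∣_∣ (rearrange (x m) (y m) (x n) (y n)) ⟩
      ∣ (x m ℚ.- x n) ℚ.+ (y m ℚ.- y n) ∣  ≤⟨ ℚₚ.∣p+q∣≤∣p∣+∣q∣ (x m ℚ.- x n) (y m ℚ.- y n) ⟩
      ∣ x m ℚ.- x n ∣ ℚ.+ ∣ y m ℚ.- y n ∣  <⟨ ℚₚ.+-mono-<
        (hx m n (ℕₚ.m⊔n≤o⇒m≤o M N ≤m) (ℕₚ.m⊔n≤o⇒m≤o M N ≤n))
        (hy m n (ℕₚ.m⊔n≤o⇒n≤o M N ≤m) (ℕₚ.m⊔n≤o⇒n≤o M N ≤n)) ⟩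
      ε ℚ.* ½ ℚ.+ ε ℚ.* ½                  ≡⟨ halves ε ⟩
      ε                                    ∎
      where
      open ℚₚ.≤-Reasoning
      open +-*-Solver
      rearrange : ∀ a b c d → (a ℚ.+ b) ℚ.- (c ℚ.+ d) ≡ (a ℚ.- c) ℚ.+ (b ℚ.- d)
      rearrange = solve 4 (λ a b c d → (a :+ b) :- (c :+ d) := (a :- c) :+ (b :- d)) refl

  inverse : ∀ p → 0ℚ ℚ.< p → ∃[ c ] (0ℚ ℚ.< c × c ℚ.* p ≡ 1ℚ)
  inverse p 0<p =
    ℚ.1/ p , ℚₚ.positive⁻¹ (ℚ.1/ p) {{ℚₚ.1/pos⇒pos p}} , ℚₚ.*-inverseˡ p
    where
    instance
      p-pos : ℚ.Positive p
      p-pos = ℚ.positive 0<p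
      p-nonZero : ℚ.NonZero p
      p-nonZero = ℚₚ.pos⇒nonZero p

  splitTolerance : ∀ {A B ε} → 0ℚ ℚ.< A → 0ℚ ℚ.< B → 0ℚ ℚ.< ε →
    ∃[ δ ] (0ℚ ℚ.< δ × A ℚ.* δ ℚ.+ δ ℚ.* B ≡ ε)
  splitTolerance {A} {B} {ε} 0<A 0<B 0<ε
    with c , 0<c , c[A+B]≡1 ← inverse (A ℚ.+ B) (ℚₚ.+-mono-< 0<A 0<B) =
    ε ℚ.* c ,
    ℚₚ.positive⁻¹ (ε ℚ.* c)
      {{ℚₚ.pos*pos⇒pos ε {{ℚ.positive 0<ε}} c {{ℚ.positive 0<c}}}} ,
    trans (factor A B ε c)
      (trans (cong (ε ℚ.*_) c[A+B]≡1) (ℚₚ.*-identityʳ ε))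
    where
    open +-*-Solver
    factor : ∀ a b e c → a ℚ.* (e ℚ.* c) ℚ.+ (e ℚ.* c) ℚ.* b ≡ e ℚ.* (c ℚ.* (a ℚ.+ b))
    factor = solve 4 (λ a b e c → a :* (e :* c) :+ (e :* c) :* b := e :* (c :* (a :+ b))) refl

  product-close : ∀ {A B δ} a b c d → 0ℚ ℚ.< A → 0ℚ ℚ.< B →
    ∣ a ∣ ℚ.≤ A → ∣ d ∣ ℚ.≤ B → ∣ a ℚ.- c ∣ ℚ.< δ → ∣ b ℚ.- d ∣ ℚ.< δ →
    ∣ a ℚ.* b ℚ.- c ℚ.* d ∣ ℚ.< A ℚ.* δ ℚ.+ δ ℚ.* B
  product-close {A} {B} {δ} a b c d 0<A 0<B a≤A d≤B a-c<δ b-d<δ = begin-strict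
    ∣ a ℚ.* b ℚ.- c ℚ.* d ∣
      ≡⟨ cong ∣_∣ (rearrange a b c d) ⟩
    ∣ a ℚ.* (b ℚ.- d) ℚ.+ (a ℚ.- c) ℚ.* d ∣
      ≤⟨ ℚₚ.∣p+q∣≤∣p∣+∣q∣ (a ℚ.* (b ℚ.- d)) ((a ℚ.- c) ℚ.* d) ⟩
    ∣ a ℚ.* (b ℚ.- d) ∣ ℚ.+ ∣ (a ℚ.- c) ℚ.* d ∣
      ≡⟨ cong₂ ℚ._+_ (ℚₚ.∣p*q∣≡∣p∣*∣q∣ a (b ℚ.- d)) (ℚₚ.∣p*q∣≡∣p∣*∣q∣ (a ℚ.- c) d) ⟩
    ∣ a ∣ ℚ.* ∣ b ℚ.- d ∣ ℚ.+ ∣ a ℚ.- c ∣ ℚ.* ∣ d ∣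
      ≤⟨ ℚₚ.+-mono-≤
           (ℚₚ.*-monoʳ-≤-nonNeg ∣ b ℚ.- d ∣ {{ℚₚ.∣-∣-nonNeg (b ℚ.- d)}} a≤A)
           (ℚₚ.*-monoˡ-≤-nonNeg ∣ a ℚ.- c ∣ {{ℚₚ.∣-∣-nonNeg (a ℚ.- c)}} d≤B) ⟩
    A ℚ.* ∣ b ℚ.- d ∣ ℚ.+ ∣ a ℚ.- c ∣ ℚ.* B
      <⟨ ℚₚ.+-mono-<
           (ℚₚ.*-monoʳ-<-pos A {{ℚ.positive 0<A}} b-d<δ)
           (ℚₚ.*-monoˡ-<-pos B {{ℚ.positive 0<B}} a-c<δ) ⟩
    A ℚ.* δ ℚ.+ δ ℚ.* B ∎
    where
    open ℚₚ.≤-Reasoning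
    open +-*-Solver
    rearrange : ∀ a b c d →
      a ℚ.* b ℚ.- c ℚ.* d ≡ a ℚ.* (b ℚ.- d) ℚ.+ (a ℚ.- c) ℚ.* d
    rearrange = solve 4 (λ a b c d →
      a :* b :- c :* d := a :* (b :- d) :+ (a :- c) :* d) refl

  *-cauchy : ∀ {x y} → IsCauchy x → IsCauchy y → IsCauchy (λ n → x n ℚ.* y n)
  *-cauchy {x} {y} cx cy ε 0<ε =
    let A , 0<A , K , ∣x∣≤A = eventuallyBounded {x} cx
        B , 0<B , L , ∣y∣≤B = eventuallyBounded {y} cy
        δ , 0<δ , Aδ+δB≡ε   = splitTolerance 0<A 0<B 0<ε
        M , hx = cx δ 0<δ
        N , hy = cy δ 0<δ
    in (K ⊔ L) ⊔ (M ⊔ N) , λ m n ≤m ≤n →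
    let KL≤m = ℕₚ.m⊔n≤o⇒m≤o (K ⊔ L) (M ⊔ N) ≤m
        KL≤n = ℕₚ.m⊔n≤o⇒m≤o (K ⊔ L) (M ⊔ N) ≤n
        MN≤m = ℕₚ.m⊔n≤o⇒n≤o (K ⊔ L) (M ⊔ N) ≤m
        MN≤n = ℕₚ.m⊔n≤o⇒n≤o (K ⊔ L) (M ⊔ N) ≤n
    in subst (∣ x m ℚ.* y m ℚ.- x n ℚ.* y n ∣ ℚ.<_) Aδ+δB≡ε
      (product-close (x m) (y m) (x n) (y n) 0<A 0<B
        (∣x∣≤A m (ℕₚ.m⊔n≤o⇒m≤o K L KL≤m)) (∣y∣≤B n (ℕₚ.m⊔n≤o⇒n≤o K L KL≤n))
        (hx m n (ℕₚ.m⊔n≤o⇒m≤o M N MN≤m) (ℕₚ.m⊔n≤o⇒m≤o M N MN≤n))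
        (hy m n (ℕₚ.m⊔n≤o⇒n≤o M N MN≤m) (ℕₚ.m⊔n≤o⇒n≤o M N MN≤n)))

-- Equality of reals is _≃_, not _≡_ on representatives.
record ℝ : Set where
  constructor mkℝ
  field
    seq    : ℕ → ℚ
    cauchy : IsCauchy seq

open ℝ public

infix  4 _≃_ _≤_ _<_
infixl 6 _+_
infixl 7 _*_

_≃_ : ℝ → ℝ → Set
x ≃ y = ∀ ε → 0ℚ ℚ.< ε →
  ∃[ N ] (∀ n → N ℕ.≤ n → ∣ seq x n ℚ.- seq y n ∣ ℚ.< ε)

_≤_ : ℝ → ℝ → Set
x ≤ y = ∀ ε → 0ℚ ℚ.< ε →
  ∃[ N ] (∀ n → N ℕ.≤ n → seq x n ℚ.< seq y n ℚ.+ ε)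

_<_ : ℝ → ℝ → Set
x < y = ∃[ ε ] (0ℚ ℚ.< ε ×
  ∃[ N ] (∀ n → N ℕ.≤ n → seq x n ℚ.+ ε ℚ.< seq y n))

fromℚ : ℚ → ℝ
fromℚ q = mkℝ (λ _ → q) (const-cauchy q)

fromℤ : ℤ → ℝ
fromℤ z = fromℚ (z ℚ./ 1)

0ℝ 1ℝ : ℝ
0ℝ = fromℚ 0ℚ
1ℝ = fromℚ 1ℚ

_+_ : ℝ → ℝ → ℝ
x + y = mkℝ (λ n → seq x n ℚ.+ seq y n) (+-cauchy {seq x} {seq y} (cauchy x) (cauchy y))

_*_ : ℝ → ℝ → ℝ
x * y = mkℝ (λ n → seq x n ℚ.* seq y n) (*-cauchy {seq x} {seq y} (cauchy x) (cauchy y))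

sum : ∀ {n} → Vector ℝ n → ℝ
sum = foldr _+_ 0ℝ

ℝ^ : ℕ → Set
ℝ^ d = Vector ℝ d

convexHull : ∀ {d k} → Vector (ℝ^ d) k → Pred (ℝ^ d) 0ℓ
convexHull {k = k} v x = Σ[ c ∈ Vector ℝ k ]
  ((∀ i → 0ℝ ≤ c i) × sum c ≃ 1ℝ × (∀ j → x j ≃ sum (λ i → c i * v i j)))

IsRationalPolytope : ∀ {d} → Pred (ℝ^ d) 0ℓ → Set
IsRationalPolytope {d} P = ∃[ k ] Σ[ v ∈ Vector (Vector ℚ d) k ]
  (P ≐ convexHull (λ i j → fromℚ (v i j)))

-- Lattice points are Vecs rather than functions, so that _≡_ on them is the
-- intended equality, as needed for counting.
embed : ∀ {d} → Vec ℤ d → ℝ^ d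
embed z j = fromℤ (lookup z j)

translate : ∀ {d} → Pred (ℝ^ d) 0ℓ → Vec ℤ d → Pred (ℝ^ d) 0ℓ
translate P w y = ∃[ x ] (P x × (∀ j → y j ≃ x j + embed w j))

dilate : ∀ {d} → ℝ → Pred (ℝ^ d) 0ℓ → Pred (ℝ^ d) 0ℓ
dilate s P y = ∃[ x ] (P x × (∀ j → y j ≃ s * x j))

HasCardinality : {A : Set} → Pred A 0ℓ → ℕ → Set
HasCardinality {A} S n = Σ[ xs ∈ List A ]
  (Unique xs × (∀ a → a ∈ xs ⇔ S a) × length xs ≡ n)

-- The graph of L_P: `Ehrhart P s n` means L_P(s) = n. Membership of a lattice
-- point in sP is undecidable for a general real s, so L_P is not available as
-- a function ℝ → ℕ.
Ehrhart : ∀ {d} → Pred (ℝ^ d) 0ℓ → ℝ → ℕ → Set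
Ehrhart P s n = HasCardinality (λ z → dilate s P (embed z)) n

{-# OPTIONS --safe #-}
module Submission where

-- Let x = a/N be a vertex of P, with a integral, and put s = N/(1 + Nκ) and
-- w = κa for a positive integer κ. Then s(x + w) = a, so the lattice point a
-- lies in s(P + w). Distinct lattice points are at distance 1/s > κ after
-- undoing the scaling, so for κ large compared with P and Q no other lattice
-- point lies in s(P + w) or s(Q + w). Hence L_{P+w}(s) = 1, so L_{Q+w}(s) = 1,
-- and the only candidate for its lattice point is a, that is, x ∈ Q. Thus every
-- vertex of P lies in the convex set Q, and symmetrically.

open import Defs
open import Data.Nat.Base as ℕ using (ℕ; zero; suc; _⊔_)
open import Data.Integer.Base as ℤ using (ℤ; +_; -[1+_])
open import Data.Vec.Base using (Vec; []; _∷_; lookup; map)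
open import Function.Bundles using (_⇔_; mk⇔; Equivalence)
open import Level using (0ℓ)
open import Relation.Unary using (Pred; _⊆_; _≐_)
open import Algebra.Bundles using (CommutativeRing)
import Algebra.Properties.Semiring.Sum as SemiringSum
open import Data.Fin.Base using (Fin; zero; suc)
import Data.Integer.Properties as ℤₚ
open import Data.List.Base using ([]; _∷_)
open import Data.List.Relation.Unary.All using ([])
open import Data.List.Relation.Unary.AllPairs using ([]; _∷_)
open import Data.List.Relation.Unary.Any using (here)
open import Data.Nat.Coprimality as C using (1-coprimeTo)
import Data.Nat.Properties as ℕₚ
open import Data.Product.Base using (∃-syntax; Σ-syntax; _×_; _,_; proj₁; proj₂)
open import Data.Rational.Base as ℚ using (ℚ; mkℚ; 0ℚ; 1ℚ; ½; ∣_∣; ↥_; ↧_; *<*)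
import Data.Rational.Properties as ℚₚ
open import Data.Rational.Solver using (module +-*-Solver)
import Data.Rational.Unnormalised.Base as ℚᵘ
open import Data.Sum.Base using (inj₁; inj₂)
open import Data.Vec.Functional using (Vector)
open import Data.Vec.Properties using (lookup-map; tabulate∘lookup; tabulate-cong)
open import Function.Base using (_∘_)
open import Relation.Binary.PropositionalEquality
  using (_≡_; refl; sym; trans; cong; cong₂; subst; module ≡-Reasoning)

open SemiringSum (CommutativeRing.semiring ℚₚ.+-*-commutativeRing)
  using (sum-cong-≗; ∑-comm; ∑-distrib-+; *-distribˡ-sum; *-distribʳ-sum; sum-replicate-zero)
  renaming (sum to sumℚ)

-- Integers inside the rationals, absolute values and inverses.

ι : ℤ → ℚ
ι z = z ℚ./ 1

-- The division in `ι` normalises by a gcd and is stuck on a variable, whereas `mkℚ z 0` exposes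
-- numerator and denominator, so that sums, products and comparisons compute after rewriting.
ι≡mkℚ : ∀ z → ι z ≡ mkℚ z 0 (C.sym (1-coprimeTo ℤ.∣ z ∣))
ι≡mkℚ z = ℚₚ.↥p/↧p≡p (mkℚ z 0 (C.sym (1-coprimeTo ℤ.∣ z ∣)))

ι-homo-* : ∀ m n → ι (m ℤ.* n) ≡ ι m ℚ.* ι n
ι-homo-* m n = sym (cong₂ ℚ._*_ (ι≡mkℚ m) (ι≡mkℚ n))

ι-homo-+ : ∀ m n → ι (m ℤ.+ n) ≡ ι m ℚ.+ ι n
ι-homo-+ m n = sym (trans (cong₂ ℚ._+_ (ι≡mkℚ m) (ι≡mkℚ n))
  (cong ι (cong₂ ℤ._+_ (ℤₚ.*-identityʳ m) (ℤₚ.*-identityʳ n))))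

ι-cancel-< : ∀ {m n} → ι m ℚ.< ι n → m ℤ.< n
ι-cancel-< {m} {n} m<n rewrite ι≡mkℚ m | ι≡mkℚ n =
  ℤₚ.*-cancelʳ-<-nonNeg (+ 1) (ℚₚ.drop-*<* m<n)

ι-positive : ∀ n → 0ℚ ℚ.< ι (+ suc n)
ι-positive n = ℚₚ.positive⁻¹ (ι (+ suc n)) {{ℚₚ.normalize-pos (suc n) 1}}

-- The product on the left is the image under `fromℚᵘ` of an unnormalised fraction with denominator
-- `1 * suc d`, which computes to `suc (d + 0)`; cross-multiplication then settles the equality.
↧p*p≡↥p : ∀ p → ι (↧ p) ℚ.* p ≡ ι (↥ p)
↧p*p≡↥p p@(mkℚ a d _) =
  trans (cong (ℚ._* p) (ι≡mkℚ (+ suc d)))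
    (ℚₚ.fromℚᵘ-cong {ℚᵘ.mkℚᵘ (+ suc d ℤ.* a) (d ℕ.+ 0)} {ℚᵘ.mkℚᵘ a 0} (ℚᵘ.*≡* (begin
      + suc d ℤ.* a ℤ.* + 1    ≡⟨ ℤₚ.*-identityʳ (+ suc d ℤ.* a) ⟩
      + suc d ℤ.* a            ≡⟨ ℤₚ.*-comm (+ suc d) a ⟩
      a ℤ.* + suc d            ≡⟨ cong (λ e → a ℤ.* + suc e) (sym (ℕₚ.+-identityʳ d)) ⟩
      a ℤ.* + suc (d ℕ.+ 0)    ∎)))
  where open ≡-Reasoning

-- For p ≥ 0 the numerator n serves, as dividing it by a positive integer cannot increase it; a
-- negative p lies below 1.
archimedean : ∀ p → ∃[ k ] p ℚ.< ι (+ suc k)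
archimedean (mkℚ (+ n) d c) = n , subst (mkℚ (+ n) d c ℚ.<_) (sym (ι≡mkℚ (+ suc n)))
  (*<* (subst (ℤ._< + suc n ℤ.* + suc d) (sym (ℤₚ.*-identityʳ (+ n)))
    (ℤ.+<+ (ℕₚ.m≤m*n (suc n) (suc d)))))
archimedean (mkℚ -[1+ n ] d c) = 0 , subst (mkℚ -[1+ n ] d c ℚ.<_) (sym (ι≡mkℚ (+ 1)))
  (*<* (subst (ℤ._< + 1 ℤ.* + suc d) (sym (ℤₚ.*-identityʳ -[1+ n ])) ℤ.-<+))

p≤∣p∣ : ∀ p → p ℚ.≤ ∣ p ∣
p≤∣p∣ p with ℚₚ.≤-total 0ℚ p
... | inj₁ 0≤p = ℚₚ.≤-reflexive (sym (ℚₚ.0≤p⇒∣p∣≡p 0≤p))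
... | inj₂ p≤0 = ℚₚ.≤-trans p≤0 (ℚₚ.0≤∣p∣ p)

∣p-q∣≡∣q-p∣ : ∀ p q → ∣ p ℚ.- q ∣ ≡ ∣ q ℚ.- p ∣
∣p-q∣≡∣q-p∣ p q = trans (cong ∣_∣ (flip p q)) (ℚₚ.∣-p∣≡∣p∣ (q ℚ.- p))
  where
  open +-*-Solver
  flip : ∀ a b → a ℚ.- b ≡ ℚ.- (b ℚ.- a)
  flip = solve 2 (λ a b → a :- b := :- (b :- a)) refl

∣p∣≤∣p-q∣+∣q∣ : ∀ p q → ∣ p ∣ ℚ.≤ ∣ p ℚ.- q ∣ ℚ.+ ∣ q ∣
∣p∣≤∣p-q∣+∣q∣ p q = subst (ℚ._≤ ∣ p ℚ.- q ∣ ℚ.+ ∣ q ∣) (cong ∣_∣ (split p q))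
  (ℚₚ.∣p+q∣≤∣p∣+∣q∣ (p ℚ.- q) q)
  where
  open +-*-Solver
  split : ∀ a b → (a ℚ.- b) ℚ.+ b ≡ a
  split = solve 2 (λ a b → (a :- b) :+ b := a) refl

∣p-q∣<ε⇒p<q+ε : ∀ p q {ε} → ∣ p ℚ.- q ∣ ℚ.< ε → p ℚ.< q ℚ.+ ε
∣p-q∣<ε⇒p<q+ε p q {ε} close = begin-strict
  p                    ≡⟨ split p q ⟩
  q ℚ.+ (p ℚ.- q)      ≤⟨ ℚₚ.+-monoʳ-≤ q (p≤∣p∣ (p ℚ.- q)) ⟩
  q ℚ.+ ∣ p ℚ.- q ∣    <⟨ ℚₚ.+-monoʳ-< q close ⟩
  q ℚ.+ ε              ∎
  where
  open ℚₚ.≤-Reasoning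
  open +-*-Solver
  split : ∀ a b → a ≡ b ℚ.+ (a ℚ.- b)
  split = solve 2 (λ a b → a := b :+ (a :- b)) refl

-- From ι m < ι n + 1 = ι (n + 1) follows m ≤ n, and the hypothesis is symmetric. This is how a
-- rational estimate forces two lattice points to coincide.
∣ιm-ιn∣<1⇒m≡n : ∀ {m n} → ∣ ι m ℚ.- ι n ∣ ℚ.< 1ℚ → m ≡ n
∣ιm-ιn∣<1⇒m≡n {m} {n} close = ℤₚ.≤-antisym
  (below m n close)
  (below n m (subst (ℚ._< 1ℚ) (∣p-q∣≡∣q-p∣ (ι m) (ι n)) close))
  where
  below : ∀ m n → ∣ ι m ℚ.- ι n ∣ ℚ.< 1ℚ → m ℤ.≤ n
  below m n close = subst (m ℤ.≤_) (ℤₚ.pred-suc n) (ℤₚ.i<j⇒i≤pred[j] (ι-cancel-< {m} {ℤ.suc n}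
    (subst (ι m ℚ.<_) (trans (ℚₚ.+-comm (ι n) 1ℚ) (sym (ι-homo-+ (+ 1) n)))
      (∣p-q∣<ε⇒p<q+ε (ι m) (ι n) close))))

*-pos : ∀ {p q} → 0ℚ ℚ.< p → 0ℚ ℚ.< q → 0ℚ ℚ.< p ℚ.* q
*-pos {p} {q} 0<p 0<q =
  ℚₚ.positive⁻¹ (p ℚ.* q) {{ℚₚ.pos*pos⇒pos p {{ℚ.positive 0<p}} q {{ℚ.positive 0<q}}}}

0<1 : 0ℚ ℚ.< 1ℚ
0<1 = ℚₚ.positive⁻¹ 1ℚ

0<½ : 0ℚ ℚ.< ½
0<½ = ℚₚ.positive⁻¹ ½

½p+½p≡p : ∀ p → ½ ℚ.* p ℚ.+ ½ ℚ.* p ≡ p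
½p+½p≡p p = trans (sym (ℚₚ.*-distribʳ-+ p ½ ½)) (ℚₚ.*-identityˡ p)

inverse : ∀ p → 0ℚ ℚ.< p → ∃[ c ] (0ℚ ℚ.< c × c ℚ.* p ≡ 1ℚ)
inverse p 0<p =
  ℚ.1/ p , ℚₚ.positive⁻¹ (ℚ.1/ p) {{ℚₚ.1/pos⇒pos p}} , ℚₚ.*-inverseˡ p
  where
  instance
    p-pos : ℚ.Positive p
    p-pos = ℚ.positive 0<p
    p-nonZero : ℚ.NonZero p
    p-nonZero = ℚₚ.pos⇒nonZero p

-- Common denominators and the choice of s and w.

commonDenominator : ∀ {d} (x : Vector ℚ d) →
  ∃[ n ] Σ[ a ∈ Vec ℤ d ] (∀ j → ι (+ suc n) ℚ.* x j ≡ ι (lookup a j))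
commonDenominator {zero}  x = 0 , [] , λ ()
commonDenominator {suc d} x with n , a , eq ← commonDenominator (x ∘ suc) =
  -- `n + e * suc n` is the predecessor of `suc e * suc n`, the old common denominator times the
  -- denominator `suc e` of the new coordinate.
  n ℕ.+ e ℕ.* suc n , (+ suc n) ℤ.* ↥ (x zero) ∷ map (+ suc e ℤ.*_) a , cleared
  where
  e = ℚ.denominator-1 (x zero)
  open ≡-Reasoning
  open +-*-Solver
  rotate : ∀ p q r → p ℚ.* q ℚ.* r ≡ q ℚ.* (p ℚ.* r)
  rotate = solve 3 (λ p q r → p :* q :* r := q :* (p :* r)) refl
  cleared : ∀ j → ι (+ (suc e ℕ.* suc n)) ℚ.* x j ≡
            ι (lookup ((+ suc n) ℤ.* ↥ (x zero) ∷ map (+ suc e ℤ.*_) a) j)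
  cleared zero = begin
    ι (+ (suc e ℕ.* suc n)) ℚ.* x zero
      ≡⟨ cong (λ m → ι m ℚ.* x zero) (ℤₚ.pos-* (suc e) (suc n)) ⟩
    ι (+ suc e ℤ.* + suc n) ℚ.* x zero
      ≡⟨ cong (ℚ._* x zero) (ι-homo-* (+ suc e) (+ suc n)) ⟩
    ι (+ suc e) ℚ.* ι (+ suc n) ℚ.* x zero
      ≡⟨ rotate (ι (+ suc e)) (ι (+ suc n)) (x zero) ⟩
    ι (+ suc n) ℚ.* (ι (+ suc e) ℚ.* x zero)
      ≡⟨ cong (ι (+ suc n) ℚ.*_) (↧p*p≡↥p (x zero)) ⟩
    ι (+ suc n) ℚ.* ι (↥ (x zero))
      ≡⟨ ι-homo-* (+ suc n) (↥ (x zero)) ⟨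
    ι ((+ suc n) ℤ.* ↥ (x zero)) ∎
  cleared (suc j) = begin
    ι (+ (suc e ℕ.* suc n)) ℚ.* x (suc j)
      ≡⟨ cong (λ m → ι m ℚ.* x (suc j)) (ℤₚ.pos-* (suc e) (suc n)) ⟩
    ι (+ suc e ℤ.* + suc n) ℚ.* x (suc j)
      ≡⟨ cong (ℚ._* x (suc j)) (ι-homo-* (+ suc e) (+ suc n)) ⟩
    ι (+ suc e) ℚ.* ι (+ suc n) ℚ.* x (suc j)
      ≡⟨ ℚₚ.*-assoc (ι (+ suc e)) (ι (+ suc n)) (x (suc j)) ⟩
    ι (+ suc e) ℚ.* (ι (+ suc n) ℚ.* x (suc j))
      ≡⟨ cong (ι (+ suc e) ℚ.*_) (eq j) ⟩
    ι (+ suc e) ℚ.* ι (lookup a j)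
      ≡⟨ ι-homo-* (+ suc e) (lookup a j) ⟨
    ι (+ suc e ℤ.* lookup a j)
      ≡⟨ cong ι (lookup-map j (+ suc e ℤ.*_) a) ⟨
    ι (lookup (map (+ suc e ℤ.*_) a) j) ∎

module _ {N c κ : ℚ} (0<N : 0ℚ ℚ.< N) (0<c : 0ℚ ℚ.< c)
         (cT≡1 : c ℚ.* (1ℚ ℚ.+ N ℚ.* κ) ≡ 1ℚ) where

  open +-*-Solver

  -- Here c = 1/(1 + Nκ), and s = Nc is the scaling factor. Then sκ = 1 - c < 1, so 2R < κ gives sR
  -- < 1/2.
  scale-small : ∀ {R} → R ℚ.+ R ℚ.< κ → N ℚ.* c ℚ.* R ℚ.< ½
  scale-small {R} 2R<κ = begin-strict
    N ℚ.* c ℚ.* R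
      ≡⟨ halve N c R ⟩
    ½ ℚ.* (N ℚ.* c ℚ.* (R ℚ.+ R))
      <⟨ ℚₚ.*-monoʳ-<-pos ½ (ℚₚ.*-monoʳ-<-pos (N ℚ.* c) {{ℚ.positive (*-pos 0<N 0<c)}} 2R<κ) ⟩
    ½ ℚ.* (N ℚ.* c ℚ.* κ)
      ≡⟨ cong (½ ℚ.*_) (rotate N c κ) ⟩
    ½ ℚ.* (0ℚ ℚ.+ c ℚ.* (N ℚ.* κ))
      <⟨ ℚₚ.*-monoʳ-<-pos ½ (ℚₚ.+-monoˡ-< (c ℚ.* (N ℚ.* κ)) 0<c) ⟩
    ½ ℚ.* (c ℚ.+ c ℚ.* (N ℚ.* κ))
      ≡⟨ cong (½ ℚ.*_) (factor c (N ℚ.* κ)) ⟩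
    ½ ℚ.* (c ℚ.* (1ℚ ℚ.+ N ℚ.* κ))
      ≡⟨ cong (½ ℚ.*_) cT≡1 ⟩
    ½ ℚ.* 1ℚ
      ≡⟨ ℚₚ.*-identityʳ ½ ⟩
    ½ ∎
    where
    open ℚₚ.≤-Reasoning
    rotate : ∀ N c κ → N ℚ.* c ℚ.* κ ≡ 0ℚ ℚ.+ c ℚ.* (N ℚ.* κ)
    rotate = solve 3 (λ N c κ → N :* c :* κ := con 0ℚ :+ c :* (N :* κ)) refl
    factor : ∀ c p → c ℚ.+ c ℚ.* p ≡ c ℚ.* (1ℚ ℚ.+ p)
    factor = solve 2 (λ c p → c :+ c :* p := c :* (con 1ℚ :+ p)) refl
    halve : ∀ N c R → N ℚ.* c ℚ.* R ≡ ½ ℚ.* (N ℚ.* c ℚ.* (R ℚ.+ R))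
    halve = solve 3 (λ N c R → N :* c :* R := con ½ :* (N :* c :* (R :+ R))) refl

  -- Translation by κNx multiplies x by 1 + Nκ, which the factor c undoes.
  scale-translate : ∀ x → N ℚ.* c ℚ.* (x ℚ.+ κ ℚ.* (N ℚ.* x)) ≡ N ℚ.* x
  scale-translate x = begin
    N ℚ.* c ℚ.* (x ℚ.+ κ ℚ.* (N ℚ.* x))    ≡⟨ regroup N c x κ ⟩
    N ℚ.* x ℚ.* (c ℚ.* (1ℚ ℚ.+ N ℚ.* κ))   ≡⟨ cong (N ℚ.* x ℚ.*_) cT≡1 ⟩
    N ℚ.* x ℚ.* 1ℚ                         ≡⟨ ℚₚ.*-identityʳ (N ℚ.* x) ⟩
    N ℚ.* x                                ∎
    where
    open ≡-Reasoning
    regroup : ∀ N c x κ → N ℚ.* c ℚ.* (x ℚ.+ κ ℚ.* (N ℚ.* x)) ≡ N ℚ.* x ℚ.* (c ℚ.* (1ℚ ℚ.+ N ℚ.* κ))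
    regroup = solve 4 (λ N c x κ →
      N :* c :* (x :+ κ :* (N :* x)) := N :* x :* (c :* (con 1ℚ :+ N :* κ))) refl

-- The integral vectors are a = Nx and w = κa, with N a common denominator of x and κ an integer
-- above 2R. The bound is 1/2 and not 1 because the other half is spent on the error of rational
-- approximations.
scaleToLattice : ∀ {d} (x : Vector ℚ d) R →
  ∃[ s ] (0ℚ ℚ.< s × s ℚ.* R ℚ.< ½ × Σ[ w ∈ Vec ℤ d ] Σ[ a ∈ Vec ℤ d ]
    (∀ j → s ℚ.* (x j ℚ.+ ι (lookup w j)) ≡ ι (lookup a j)))
scaleToLattice x R =
  let n , a , Nx≡a = commonDenominator x
      k , 2R<κ     = archimedean (R ℚ.+ R)
      c , 0<c , cT≡1 = inverse (1ℚ ℚ.+ ι (+ suc n) ℚ.* ι (+ suc k))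
                         (ℚₚ.+-mono-< 0<1 (*-pos (ι-positive n) (ι-positive k)))
  in ι (+ suc n) ℚ.* c ,
     *-pos (ι-positive n) 0<c ,
     scale-small (ι-positive n) 0<c cT≡1 2R<κ ,
     map (+ suc k ℤ.*_) a , a , λ j →
     trans (cong (λ q → ι (+ suc n) ℚ.* c ℚ.* (x j ℚ.+ q)) (begin
         ι (lookup (map (+ suc k ℤ.*_) a) j)   ≡⟨ cong ι (lookup-map j (+ suc k ℤ.*_) a) ⟩
         ι (+ suc k ℤ.* lookup a j)            ≡⟨ ι-homo-* (+ suc k) (lookup a j) ⟩
         ι (+ suc k) ℚ.* ι (lookup a j)        ≡⟨ cong (ι (+ suc k) ℚ.*_) (Nx≡a j) ⟨
         ι (+ suc k) ℚ.* (ι (+ suc n) ℚ.* x j) ∎))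
       (trans (scale-translate (ι-positive n) 0<c cT≡1 (x j)) (Nx≡a j))
  where open ≡-Reasoning

upperBound : ∀ {n} (f : Vector ℚ n) → ∃[ B ] (∀ i → f i ℚ.≤ B)
upperBound {zero}  f = 0ℚ , λ ()
upperBound {suc n} f with B , f≤B ← upperBound (f ∘ suc) =
  f zero ℚ.⊔ B , λ
    { zero    → ℚₚ.p≤p⊔q (f zero) B
    ; (suc i) → ℚₚ.≤-trans (f≤B i) (ℚₚ.p≤q⊔p (f zero) B) }

-- Sequences and real arithmetic

Eventually : (ℕ → Set) → Set
Eventually P = ∃[ N ] (∀ n → N ℕ.≤ n → P n)

ev-map : ∀ {P Q : ℕ → Set} → (∀ n → P n → Q n) → Eventually P → Eventually Q
ev-map f (N , p) = N , λ n N≤n → f n (p n N≤n)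

ev-zip : ∀ {P Q R : ℕ → Set} → (∀ n → P n → Q n → R n) →
  Eventually P → Eventually Q → Eventually R
ev-zip f (M , p) (N , q) = M ⊔ N , λ n ≤n →
  f n (p n (ℕₚ.m⊔n≤o⇒m≤o M N ≤n)) (q n (ℕₚ.m⊔n≤o⇒n≤o M N ≤n))

ev-all : ∀ {k} {P : Fin k → ℕ → Set} →
  (∀ i → Eventually (P i)) → Eventually (λ n → ∀ i → P i n)
ev-all {zero}  p = 0 , λ _ _ ()
ev-all {suc k} p = ev-zip
  (λ _ p₀ pₛ → λ { zero → p₀ ; (suc i) → pₛ i }) (p zero) (ev-all (p ∘ suc))

ev-now : ∀ {P : Set} → Eventually (λ _ → P) → P
ev-now (N , p) = p N ℕₚ.≤-refl

-- `x ≃ y` unfolds to `Null` of the termwise difference, so facts about null sequences prove `_≃_`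
-- once the difference is rearranged.
Null : (ℕ → ℚ) → Set
Null f = ∀ ε → 0ℚ ℚ.< ε → Eventually (λ n → ∣ f n ∣ ℚ.< ε)

null-ext : ∀ {f g : ℕ → ℚ} → (∀ n → f n ≡ g n) → Null f → Null g
null-ext f≡g f→0 ε 0<ε =
  ev-map (λ n → subst (λ q → ∣ q ∣ ℚ.< ε) (f≡g n)) (f→0 ε 0<ε)

null-+ : ∀ {f g : ℕ → ℚ} → Null f → Null g → Null (λ n → f n ℚ.+ g n)
null-+ {f} {g} f→0 g→0 ε 0<ε = ev-zip
  (λ n f<ε g<ε → begin-strict
    ∣ f n ℚ.+ g n ∣          ≤⟨ ℚₚ.∣p+q∣≤∣p∣+∣q∣ (f n) (g n) ⟩
    ∣ f n ∣ ℚ.+ ∣ g n ∣      <⟨ ℚₚ.+-mono-< f<ε g<ε ⟩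
    ½ ℚ.* ε ℚ.+ ½ ℚ.* ε      ≡⟨ ½p+½p≡p ε ⟩
    ε                        ∎)
  (f→0 (½ ℚ.* ε) 0<ε/2) (g→0 (½ ℚ.* ε) 0<ε/2)
  where
  open ℚₚ.≤-Reasoning
  0<ε/2 : 0ℚ ℚ.< ½ ℚ.* ε
  0<ε/2 = *-pos 0<½ 0<ε

Bounded : (ℕ → ℚ) → Set
Bounded f = ∃[ B ] (0ℚ ℚ.< B × Eventually (λ n → ∣ f n ∣ ℚ.≤ B))

seq-bounded : ∀ x → Bounded (seq x)
seq-bounded x with N , close ← cauchy x 1ℚ 0<1 =
  1ℚ ℚ.+ ∣ seq x N ∣ ,
  ℚₚ.+-mono-<-≤ {0ℚ} {1ℚ} {0ℚ} 0<1 (ℚₚ.0≤∣p∣ (seq x N)) ,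
  N , λ n N≤n → ℚₚ.≤-trans (∣p∣≤∣p-q∣+∣q∣ (seq x n) (seq x N))
    (ℚₚ.+-monoˡ-≤ ∣ seq x N ∣ (ℚₚ.<⇒≤ (close n N N≤n ℕₚ.≤-refl)))

null-* : ∀ {f g : ℕ → ℚ} → Bounded f → Null g → Null (λ n → f n ℚ.* g n)
null-* {f} {g} (B , 0<B , f≤B) g→0 ε 0<ε with c , 0<c , cB≡1 ← inverse B 0<B =
  ev-zip (λ n ∣f∣≤B ∣g∣<cε → begin-strict
    ∣ f n ℚ.* g n ∣          ≡⟨ ℚₚ.∣p*q∣≡∣p∣*∣q∣ (f n) (g n) ⟩
    ∣ f n ∣ ℚ.* ∣ g n ∣      ≤⟨ ℚₚ.*-monoʳ-≤-nonNeg ∣ g n ∣ {{ℚₚ.∣-∣-nonNeg (g n)}} ∣f∣≤B ⟩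
    B ℚ.* ∣ g n ∣            <⟨ ℚₚ.*-monoʳ-<-pos B {{ℚ.positive 0<B}} ∣g∣<cε ⟩
    B ℚ.* (c ℚ.* ε)          ≡⟨ regroup B c ε ⟩
    c ℚ.* B ℚ.* ε            ≡⟨ cong (ℚ._* ε) cB≡1 ⟩
    1ℚ ℚ.* ε                 ≡⟨ ℚₚ.*-identityˡ ε ⟩
    ε                        ∎)
  f≤B (g→0 (c ℚ.* ε) (*-pos 0<c 0<ε))
  where
  open ℚₚ.≤-Reasoning
  open +-*-Solver
  regroup : ∀ B c e → B ℚ.* (c ℚ.* e) ≡ c ℚ.* B ℚ.* e
  regroup = solve 3 (λ B c e → B :* (c :* e) := c :* B :* e) refl

-- The reals are explicit arguments here and below: `_≃_` unfolds to a statement about `seq` alone,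
-- from which the Cauchy proofs, hence the records, cannot be inferred.
≡⇒≃ : ∀ x y → (∀ n → seq x n ≡ seq y n) → x ≃ y
≡⇒≃ x y x≡y ε 0<ε = 0 , λ n _ → subst (ℚ._< ε)
  (sym (cong ∣_∣ (trans (cong (ℚ._- seq y n) (x≡y n)) (ℚₚ.+-inverseʳ (seq y n))))) 0<ε

≃-trans : ∀ x y z → x ≃ y → y ≃ z → x ≃ z
≃-trans x y z x≃y y≃z = null-ext (λ n → telescope (seq x n) (seq y n) (seq z n)) (null-+ x≃y y≃z)
  where
  open +-*-Solver
  telescope : ∀ a b c → (a ℚ.- b) ℚ.+ (b ℚ.- c) ≡ a ℚ.- c
  telescope = solve 3 (λ a b c → (a :- b) :+ (b :- c) := a :- c) refl

+-cong : ∀ x x′ y y′ → x ≃ x′ → y ≃ y′ → x + y ≃ x′ + y′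
+-cong x x′ y y′ x≃x′ y≃y′ = null-ext
  (λ n → interchange (seq x n) (seq x′ n) (seq y n) (seq y′ n)) (null-+ x≃x′ y≃y′)
  where
  open +-*-Solver
  interchange : ∀ a b c d → (a ℚ.- b) ℚ.+ (c ℚ.- d) ≡ (a ℚ.+ c) ℚ.- (b ℚ.+ d)
  interchange = solve 4 (λ a b c d → (a :- b) :+ (c :- d) := (a :+ c) :- (b :+ d)) refl

*-congˡ : ∀ x y y′ → y ≃ y′ → x * y ≃ x * y′
*-congˡ x y y′ y≃y′ = null-ext (λ n → distrib (seq x n) (seq y n) (seq y′ n)) (null-* (seq-bounded x) y≃y′)
  where
  open +-*-Solver
  distrib : ∀ a b c → a ℚ.* (b ℚ.- c) ≡ a ℚ.* b ℚ.- a ℚ.* c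
  distrib = solve 3 (λ a b c → a :* (b :- c) := a :* b :- a :* c) refl

sum-cong : ∀ {k} (f g : Vector ℝ k) → (∀ i → f i ≃ g i) → sum f ≃ sum g
sum-cong {zero}  f g f≃g = ≡⇒≃ 0ℝ 0ℝ λ _ → refl
sum-cong {suc k} f g f≃g = +-cong (f zero) (g zero) (sum (f ∘ suc)) (sum (g ∘ suc))
  (f≃g zero) (sum-cong (f ∘ suc) (g ∘ suc) (f≃g ∘ suc))

-- Sums of reals are formed termwise, so identities between them reduce, at each index, to semiring
-- identities for `sumℚ`.
seq-sum : ∀ {k} (f : Vector ℝ k) n → seq (sum f) n ≡ sumℚ (λ i → seq (f i) n)
seq-sum {zero}  f n = refl
seq-sum {suc k} f n = cong (seq (f zero) n ℚ.+_) (seq-sum (f ∘ suc) n)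

nonNeg-+ : ∀ x y → 0ℝ ≤ x → 0ℝ ≤ y → 0ℝ ≤ x + y
nonNeg-+ x y 0≤x 0≤y ε 0<ε = ev-zip
  (λ n 0<x 0<y → subst (0ℚ ℚ.<_) (regroup (seq x n) (seq y n)) (ℚₚ.+-mono-< 0<x 0<y))
  (0≤x (½ ℚ.* ε) (*-pos 0<½ 0<ε)) (0≤y (½ ℚ.* ε) (*-pos 0<½ 0<ε))
  where
  open +-*-Solver
  collect : ∀ a b h → (a ℚ.+ h) ℚ.+ (b ℚ.+ h) ≡ (a ℚ.+ b) ℚ.+ (h ℚ.+ h)
  collect = solve 3 (λ a b h → (a :+ h) :+ (b :+ h) := (a :+ b) :+ (h :+ h)) refl
  regroup : ∀ a b → (a ℚ.+ ½ ℚ.* ε) ℚ.+ (b ℚ.+ ½ ℚ.* ε) ≡ (a ℚ.+ b) ℚ.+ ε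
  regroup a b = trans (collect a b (½ ℚ.* ε)) (cong (a ℚ.+ b ℚ.+_) (½p+½p≡p ε))

nonNeg-sum : ∀ {k} (f : Vector ℝ k) → (∀ i → 0ℝ ≤ f i) → 0ℝ ≤ sum f
nonNeg-sum {zero}  f 0≤f ε 0<ε = 0 , λ _ _ → subst (0ℚ ℚ.<_) (sym (ℚₚ.+-identityˡ ε)) 0<ε
nonNeg-sum {suc k} f 0≤f =
  nonNeg-+ (f zero) (sum (f ∘ suc)) (0≤f zero) (nonNeg-sum (f ∘ suc) (0≤f ∘ suc))

-- (p + δ)(q + δ) = pq + δ(p + q + δ), and δ is chosen so that the error is below ε.
module _ {A B ε c : ℚ} (0<A : 0ℚ ℚ.< A) (0<B : 0ℚ ℚ.< B) (0<ε : 0ℚ ℚ.< ε) (0<c : 0ℚ ℚ.< c)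
         (cC≡1 : c ℚ.* (A ℚ.+ B ℚ.+ (1ℚ ℚ.+ ε)) ≡ 1ℚ) where

  open ℚₚ.≤-Reasoning

  -- The product c(A + B + 1 + ε) is 1 and exceeds its part cε, so εc < 1. With δ = εc this bounds
  -- the last δ in the error term δ(p + q + δ).
  εc<1+ε : ε ℚ.* c ℚ.< 1ℚ ℚ.+ ε
  εc<1+ε = begin-strict
    ε ℚ.* c                              ≡⟨ ℚₚ.*-comm ε c ⟩
    c ℚ.* ε                              ≡⟨ cong (c ℚ.*_) (ℚₚ.+-identityˡ ε) ⟨
    c ℚ.* (0ℚ ℚ.+ ε)                     <⟨ ℚₚ.*-monoʳ-<-pos c {{ℚ.positive 0<c}} (ℚₚ.+-monoˡ-< ε
                                              (ℚₚ.+-mono-< (ℚₚ.+-mono-< 0<A 0<B) 0<1)) ⟩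
    c ℚ.* (A ℚ.+ B ℚ.+ 1ℚ ℚ.+ ε)         ≡⟨ cong (c ℚ.*_) (ℚₚ.+-assoc (A ℚ.+ B) 1ℚ ε) ⟩
    c ℚ.* (A ℚ.+ B ℚ.+ (1ℚ ℚ.+ ε))       ≡⟨ cC≡1 ⟩
    1ℚ                                   ≡⟨ ℚₚ.+-identityʳ 1ℚ ⟨
    1ℚ ℚ.+ 0ℚ                            <⟨ ℚₚ.+-monoʳ-< 1ℚ 0<ε ⟩
    1ℚ ℚ.+ ε                             ∎

  product-almost-nonNeg : ∀ p q → 0ℚ ℚ.< p ℚ.+ ε ℚ.* c → 0ℚ ℚ.< q ℚ.+ ε ℚ.* c →
    p ℚ.≤ A → q ℚ.≤ B → 0ℚ ℚ.< p ℚ.* q ℚ.+ ε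
  product-almost-nonNeg p q 0<p 0<q p≤A q≤B = begin-strict
    0ℚ
      <⟨ *-pos 0<p 0<q ⟩
    (p ℚ.+ ε ℚ.* c) ℚ.* (q ℚ.+ ε ℚ.* c)
      ≡⟨ expand p q (ε ℚ.* c) ⟩
    p ℚ.* q ℚ.+ ε ℚ.* c ℚ.* (p ℚ.+ q ℚ.+ ε ℚ.* c)
      <⟨ ℚₚ.+-monoʳ-< (p ℚ.* q) (ℚₚ.*-monoʳ-<-pos (ε ℚ.* c) {{ℚ.positive (*-pos 0<ε 0<c)}}
           (ℚₚ.+-mono-≤-< (ℚₚ.+-mono-≤ p≤A q≤B) εc<1+ε)) ⟩
    p ℚ.* q ℚ.+ ε ℚ.* c ℚ.* (A ℚ.+ B ℚ.+ (1ℚ ℚ.+ ε))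
      ≡⟨ cong (p ℚ.* q ℚ.+_) (ℚₚ.*-assoc ε c (A ℚ.+ B ℚ.+ (1ℚ ℚ.+ ε))) ⟩
    p ℚ.* q ℚ.+ ε ℚ.* (c ℚ.* (A ℚ.+ B ℚ.+ (1ℚ ℚ.+ ε)))
      ≡⟨ cong (λ r → p ℚ.* q ℚ.+ ε ℚ.* r) cC≡1 ⟩
    p ℚ.* q ℚ.+ ε ℚ.* 1ℚ
      ≡⟨ cong (p ℚ.* q ℚ.+_) (ℚₚ.*-identityʳ ε) ⟩
    p ℚ.* q ℚ.+ ε ∎
    where
    open +-*-Solver
    expand : ∀ p q δ → (p ℚ.+ δ) ℚ.* (q ℚ.+ δ) ≡ p ℚ.* q ℚ.+ δ ℚ.* (p ℚ.+ q ℚ.+ δ)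
    expand = solve 3 (λ p q δ → (p :+ δ) :* (q :+ δ) := p :* q :+ δ :* (p :+ q :+ δ)) refl

-- Terms of a nonnegative real may be slightly negative, so signs alone do not settle the product;
-- bounds on the terms of both factors decide how small the deviation has to be.
nonNeg-* : ∀ x y → 0ℝ ≤ x → 0ℝ ≤ y → 0ℝ ≤ x * y
nonNeg-* x y 0≤x 0≤y ε 0<ε =
  let A , 0<A , x≤A  = seq-bounded x
      B , 0<B , y≤B  = seq-bounded y
      c , 0<c , cC≡1 = inverse (A ℚ.+ B ℚ.+ (1ℚ ℚ.+ ε))
                         (ℚₚ.+-mono-< (ℚₚ.+-mono-< 0<A 0<B) (ℚₚ.+-mono-< 0<1 0<ε))
  in ev-zip (λ n (0<x , x≤A) (0<y , y≤B) →
       product-almost-nonNeg 0<A 0<B 0<ε 0<c cC≡1 (seq x n) (seq y n) 0<x 0<y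
         (ℚₚ.≤-trans (p≤∣p∣ (seq x n)) x≤A) (ℚₚ.≤-trans (p≤∣p∣ (seq y n)) y≤B))
     (ev-zip (λ _ → _,_) (0≤x (ε ℚ.* c) (*-pos 0<ε 0<c)) x≤A)
     (ev-zip (λ _ → _,_) (0≤y (ε ℚ.* c) (*-pos 0<ε 0<c)) y≤B)

-- Convex combinations of convex combinations.

sumℚ-interchange : ∀ {k l} (c : Vector ℚ k) (f : Fin k → Vector ℚ l) →
  sumℚ (λ i → c i ℚ.* sumℚ (f i)) ≡ sumℚ (λ m → sumℚ (λ i → c i ℚ.* f i m))
sumℚ-interchange c f = trans
  (sum-cong-≗ (λ i → *-distribˡ-sum (c i) (f i)))
  (∑-comm (λ i m → c i ℚ.* f i m))

-- An arbitrary predicate need not be invariant under `_≃_`; a convex hull is, because the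
-- coordinates enter only through `_≃_`.
convexHull-resp-≃ : ∀ {d k} (v : Vector (ℝ^ d) k) (x y : ℝ^ d) → (∀ j → y j ≃ x j) →
  convexHull v x → convexHull v y
convexHull-resp-≃ v x y y≃x (c , 0≤c , Σc≃1 , x≃Σcv) = c , 0≤c , Σc≃1 ,
  λ j → ≃-trans (y j) (x j) (sum (λ i → c i * v i j)) (y≃x j) (x≃Σcv j)

-- If v i is the combination of the u m with weights e i m, then x is the combination of the u m
-- with weights g m, the sum over i of c i times e i m. Exchanging the two sums gives both the total
-- weight and the coordinates.
convexHull-⊆ : ∀ {d k l} (v : Vector (ℝ^ d) k) (u : Vector (ℝ^ d) l) →
  (∀ i → convexHull u (v i)) → convexHull v ⊆ convexHull u
convexHull-⊆ {k = k} {l} v u v∈u {x} (c , 0≤c , Σc≃1 , x≃Σcv) =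
  g , (λ m → nonNeg-sum _ λ i → nonNeg-* (c i) (e i m) (0≤c i) (proj₁ (proj₂ (v∈u i)) m)) ,
  Σg≃1 , x≃Σgu
  where
  e : Fin k → Vector ℝ l
  e i = proj₁ (v∈u i)
  g : Vector ℝ l
  g m = sum (λ i → c i * e i m)
  open ≡-Reasoning

  Σg≃1 : sum g ≃ 1ℝ
  Σg≃1 = ≃-trans (sum g) (sum λ i → c i * sum (e i)) 1ℝ
      (≡⇒≃ (sum g) (sum λ i → c i * sum (e i)) λ n → sym (begin
        seq (sum λ i → c i * sum (e i)) n
          ≡⟨ seq-sum (λ i → c i * sum (e i)) n ⟩
        sumℚ (λ i → seq (c i) n ℚ.* seq (sum (e i)) n)
          ≡⟨ sum-cong-≗ (λ i → cong (seq (c i) n ℚ.*_) (seq-sum (e i) n)) ⟩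
        sumℚ (λ i → seq (c i) n ℚ.* sumℚ (λ m → seq (e i m) n))
          ≡⟨ sumℚ-interchange (λ i → seq (c i) n) (λ i m → seq (e i m) n) ⟩
        sumℚ (λ m → sumℚ (λ i → seq (c i) n ℚ.* seq (e i m) n))
          ≡⟨ sum-cong-≗ (λ m → seq-sum (λ i → c i * e i m) n) ⟨
        sumℚ (λ m → seq (g m) n)
          ≡⟨ seq-sum g n ⟨
        seq (sum g) n ∎))
    (≃-trans (sum λ i → c i * sum (e i)) (sum λ i → c i * 1ℝ) 1ℝ
      (sum-cong (λ i → c i * sum (e i)) (λ i → c i * 1ℝ)
        (λ i → *-congˡ (c i) (sum (e i)) 1ℝ (proj₁ (proj₂ (proj₂ (v∈u i))))))
      (≃-trans (sum λ i → c i * 1ℝ) (sum c) 1ℝ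
        (sum-cong (λ i → c i * 1ℝ) c
          (λ i → ≡⇒≃ (c i * 1ℝ) (c i) λ n → ℚₚ.*-identityʳ (seq (c i) n)))
        Σc≃1))

  x≃Σgu : ∀ j → x j ≃ sum (λ m → g m * u m j)
  x≃Σgu j = ≃-trans (x j) (sum λ i → c i * v i j) (sum λ m → g m * u m j) (x≃Σcv j)
    (≃-trans (sum λ i → c i * v i j) (sum λ i → c i * w i) (sum λ m → g m * u m j)
      (sum-cong (λ i → c i * v i j) (λ i → c i * w i)
        (λ i → *-congˡ (c i) (v i j) (w i) (proj₂ (proj₂ (proj₂ (v∈u i))) j)))
      (≡⇒≃ (sum λ i → c i * w i) (sum λ m → g m * u m j) λ n → begin
        seq (sum λ i → c i * w i) n
          ≡⟨ seq-sum (λ i → c i * w i) n ⟩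
        sumℚ (λ i → seq (c i) n ℚ.* seq (w i) n)
          ≡⟨ sum-cong-≗ (λ i → cong (seq (c i) n ℚ.*_) (seq-sum (λ m → e i m * u m j) n)) ⟩
        sumℚ (λ i → seq (c i) n ℚ.* sumℚ (λ m → seq (e i m) n ℚ.* seq (u m j) n))
          ≡⟨ sumℚ-interchange (λ i → seq (c i) n) (λ i m → seq (e i m) n ℚ.* seq (u m j) n) ⟩
        sumℚ (λ m → sumℚ (λ i → seq (c i) n ℚ.* (seq (e i m) n ℚ.* seq (u m j) n)))
          ≡⟨ sum-cong-≗ (λ m → sum-cong-≗ λ i →
               ℚₚ.*-assoc (seq (c i) n) (seq (e i m) n) (seq (u m j) n)) ⟨
        sumℚ (λ m → sumℚ (λ i → seq (c i) n ℚ.* seq (e i m) n ℚ.* seq (u m j) n))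
          ≡⟨ sum-cong-≗ (λ m → *-distribʳ-sum (seq (u m j) n) (λ i → seq (c i) n ℚ.* seq (e i m) n)) ⟨
        sumℚ (λ m → sumℚ (λ i → seq (c i) n ℚ.* seq (e i m) n) ℚ.* seq (u m j) n)
          ≡⟨ sum-cong-≗ (λ m → cong (ℚ._* seq (u m j) n) (seq-sum (λ i → c i * e i m) n)) ⟨
        sumℚ (λ m → seq (g m) n ℚ.* seq (u m j) n)
          ≡⟨ seq-sum (λ m → g m * u m j) n ⟨
        seq (sum λ m → g m * u m j) n ∎))
    where
    w : Vector ℝ k
    w i = sum (λ m → e i m * u m j)

-- Points of a convex hull

-- The Kronecker delta: the weights that present a single generator as a convex combination.
δ : ∀ {k} → Fin k → Fin k → ℚ
δ zero    zero    = 1ℚ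
δ zero    (suc _) = 0ℚ
δ (suc _) zero    = 0ℚ
δ (suc i) (suc m) = δ i m

sumℚ-δ : ∀ {k} (i : Fin k) (f : Vector ℚ k) → sumℚ (λ m → δ i m ℚ.* f m) ≡ f i
sumℚ-δ {suc k} zero f = trans
  (cong₂ ℚ._+_ (ℚₚ.*-identityˡ (f zero))
    (trans (sum-cong-≗ (λ m → ℚₚ.*-zeroˡ (f (suc m)))) (sum-replicate-zero k)))
  (ℚₚ.+-identityʳ (f zero))
sumℚ-δ (suc i) f = trans
  (cong₂ ℚ._+_ (ℚₚ.*-zeroˡ (f zero)) (sumℚ-δ i (f ∘ suc)))
  (ℚₚ.+-identityˡ (f (suc i)))

0≤δ : ∀ {k} (i m : Fin k) → 0ℚ ℚ.≤ δ i m
0≤δ zero    zero    = ℚₚ.<⇒≤ 0<1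
0≤δ zero    (suc _) = ℚₚ.≤-refl
0≤δ (suc _) zero    = ℚₚ.≤-refl
0≤δ (suc i) (suc m) = 0≤δ i m

vertex∈convexHull : ∀ {d k} (v : Vector (ℝ^ d) k) i → convexHull v (v i)
vertex∈convexHull v i =
  fromℚ ∘ δ i ,
  (λ m ε 0<ε → 0 , λ _ _ → ℚₚ.+-mono-≤-< {0ℚ} {δ i m} {0ℚ} (0≤δ i m) 0<ε) ,
  ≡⇒≃ (sum (fromℚ ∘ δ i)) 1ℝ (λ n → trans (seq-sum (fromℚ ∘ δ i) n)
    (trans (sum-cong-≗ (λ m → sym (ℚₚ.*-identityʳ (δ i m)))) (sumℚ-δ i (λ _ → 1ℚ)))) ,
  λ j → ≡⇒≃ (v i j) (sum (λ m → fromℚ (δ i m) * v m j)) (λ n → sym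
    (trans (seq-sum (λ m → fromℚ (δ i m) * v m j) n) (sumℚ-δ i (λ m → seq (v m j) n))))

-- Terms of a nonnegative weight are eventually above -1, but may be negative. The triangle
-- inequality through -1 gives (p + 1) + 1.
-1<p⇒∣p∣≤p+2 : ∀ p → 0ℚ ℚ.< p ℚ.+ 1ℚ → ∣ p ∣ ℚ.≤ p ℚ.+ (1ℚ ℚ.+ 1ℚ)
-1<p⇒∣p∣≤p+2 p 0<p+1 = begin
  ∣ p ∣                                 ≤⟨ ∣p∣≤∣p-q∣+∣q∣ p (ℚ.- 1ℚ) ⟩
  ∣ p ℚ.+ 1ℚ ∣ ℚ.+ 1ℚ                   ≡⟨ cong (ℚ._+ 1ℚ) (ℚₚ.0≤p⇒∣p∣≡p (ℚₚ.<⇒≤ 0<p+1)) ⟩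
  p ℚ.+ 1ℚ ℚ.+ 1ℚ                       ≡⟨ ℚₚ.+-assoc p 1ℚ 1ℚ ⟩
  p ℚ.+ (1ℚ ℚ.+ 1ℚ)                     ∎
  where open ℚₚ.≤-Reasoning

-- The bound is linear in the weights, so that adding it up involves them only through their sum,
-- which is near 1 for a convex combination.
∣sumℚ∣-bound : ∀ {k} (c v : Vector ℚ k) {B} →
  (∀ i → 0ℚ ℚ.< c i ℚ.+ 1ℚ) → (∀ i → ∣ v i ∣ ℚ.≤ B) →
  ∣ sumℚ (λ i → c i ℚ.* v i) ∣ ℚ.≤ sumℚ (λ i → (c i ℚ.+ (1ℚ ℚ.+ 1ℚ)) ℚ.* B)
∣sumℚ∣-bound {zero}  c v     -1<c v≤B = ℚₚ.≤-refl
∣sumℚ∣-bound {suc k} c v {B} -1<c v≤B = begin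
  ∣ c zero ℚ.* v zero ℚ.+ rest ∣
    ≤⟨ ℚₚ.∣p+q∣≤∣p∣+∣q∣ (c zero ℚ.* v zero) rest ⟩
  ∣ c zero ℚ.* v zero ∣ ℚ.+ ∣ rest ∣
    ≤⟨ ℚₚ.+-mono-≤ head≤ (∣sumℚ∣-bound (c ∘ suc) (v ∘ suc) (-1<c ∘ suc) (v≤B ∘ suc)) ⟩
  (c zero ℚ.+ (1ℚ ℚ.+ 1ℚ)) ℚ.* B ℚ.+ sumℚ (λ i → (c (suc i) ℚ.+ (1ℚ ℚ.+ 1ℚ)) ℚ.* B) ∎
  where
  open ℚₚ.≤-Reasoning
  rest = sumℚ (λ i → c (suc i) ℚ.* v (suc i))
  head≤ : ∣ c zero ℚ.* v zero ∣ ℚ.≤ (c zero ℚ.+ (1ℚ ℚ.+ 1ℚ)) ℚ.* B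
  head≤ = begin
    ∣ c zero ℚ.* v zero ∣            ≡⟨ ℚₚ.∣p*q∣≡∣p∣*∣q∣ (c zero) (v zero) ⟩
    ∣ c zero ∣ ℚ.* ∣ v zero ∣        ≤⟨ ℚₚ.*-monoˡ-≤-nonNeg ∣ c zero ∣
                                          {{ℚₚ.∣-∣-nonNeg (c zero)}} (v≤B zero) ⟩
    ∣ c zero ∣ ℚ.* B                 ≤⟨ ℚₚ.*-monoʳ-≤-nonNeg B
                                          {{ℚ.nonNegative (ℚₚ.≤-trans (ℚₚ.0≤∣p∣ (v zero)) (v≤B zero))}}
                                          (-1<p⇒∣p∣≤p+2 (c zero) (-1<c zero)) ⟩
    (c zero ℚ.+ (1ℚ ℚ.+ 1ℚ)) ℚ.* B   ∎

-- Stated for the rational terms and not with `_≤_` on reals, as the separation estimate compares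
-- terms at one index.
BoundedBy : ∀ {d} → ℚ → Pred (ℝ^ d) 0ℓ
BoundedBy M y = ∀ j → Eventually (λ n → ∣ seq (y j) n ∣ ℚ.≤ M)

convexHull-bounded : ∀ {d k} (v : Vector (Vector ℚ d) k) →
  ∃[ M ] convexHull (λ i j → fromℚ (v i j)) ⊆ BoundedBy M
convexHull-bounded {d} {k} v = M , λ {y} → bound {y}
  where
  row = λ i → upperBound (λ j → ∣ v i j ∣)
  top = upperBound (proj₁ ∘ row)
  -- The maximum with 0 secures the sign needed to multiply inequalities by B.
  B = 0ℚ ℚ.⊔ proj₁ top
  v≤B : ∀ i j → ∣ v i j ∣ ℚ.≤ B
  v≤B i j = ℚₚ.≤-trans (proj₂ (row i) j)
    (ℚₚ.≤-trans (proj₂ top i) (ℚₚ.p≤q⊔p 0ℚ (proj₁ top)))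
  0≤B : 0ℚ ℚ.≤ B
  0≤B = ℚₚ.p≤p⊔q 0ℚ (proj₁ top)
  twos = sumℚ {k} (λ _ → 1ℚ ℚ.+ 1ℚ)
  -- All approximations are taken with error 1: the first 1 is that of y, the sum of the weights is
  -- at most 1 + 1, and `twos` collects the corrections for slightly negative weights.
  M = 1ℚ ℚ.+ (1ℚ ℚ.+ 1ℚ ℚ.+ twos) ℚ.* B
  open ℚₚ.≤-Reasoning
  bound : convexHull (λ i j → fromℚ (v i j)) ⊆ BoundedBy M
  bound {y} (c , 0≤c , Σc≃1 , y≃Σcv) j = ev-zip
    (λ n (-1<c , Σc≈1) y≈Σcv → begin
      ∣ seq (y j) n ∣
        ≤⟨ ∣p∣≤∣p-q∣+∣q∣ (seq (y j) n) (seq (sum λ i → c i * fromℚ (v i j)) n) ⟩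
      ∣ seq (y j) n ℚ.- seq (sum λ i → c i * fromℚ (v i j)) n ∣ ℚ.+ ∣ seq (sum λ i → c i * fromℚ (v i j)) n ∣
        ≤⟨ ℚₚ.+-mono-≤ (ℚₚ.<⇒≤ y≈Σcv) (begin
          ∣ seq (sum λ i → c i * fromℚ (v i j)) n ∣
            ≡⟨ cong ∣_∣ (seq-sum (λ i → c i * fromℚ (v i j)) n) ⟩
          ∣ sumℚ (λ i → seq (c i) n ℚ.* v i j) ∣
            ≤⟨ ∣sumℚ∣-bound (λ i → seq (c i) n) (λ i → v i j) -1<c (λ i → v≤B i j) ⟩
          sumℚ (λ i → (seq (c i) n ℚ.+ (1ℚ ℚ.+ 1ℚ)) ℚ.* B)
            ≡⟨ *-distribʳ-sum B (λ i → seq (c i) n ℚ.+ (1ℚ ℚ.+ 1ℚ)) ⟨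
          sumℚ (λ i → seq (c i) n ℚ.+ (1ℚ ℚ.+ 1ℚ)) ℚ.* B
            ≡⟨ cong (ℚ._* B) (∑-distrib-+ (λ i → seq (c i) n) (λ _ → 1ℚ ℚ.+ 1ℚ)) ⟩
          (sumℚ (λ i → seq (c i) n) ℚ.+ twos) ℚ.* B
            ≡⟨ cong (λ q → (q ℚ.+ twos) ℚ.* B) (seq-sum c n) ⟨
          (seq (sum c) n ℚ.+ twos) ℚ.* B
            ≤⟨ ℚₚ.*-monoʳ-≤-nonNeg B {{ℚ.nonNegative 0≤B}} (ℚₚ.+-monoˡ-≤ twos
                 (ℚₚ.<⇒≤ (∣p-q∣<ε⇒p<q+ε (seq (sum c) n) 1ℚ Σc≈1))) ⟩
          (1ℚ ℚ.+ 1ℚ ℚ.+ twos) ℚ.* B ∎) ⟩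
      M ∎)
    (ev-zip (λ _ → _,_) (ev-all (λ i → 0≤c i 1ℚ 0<1)) (Σc≃1 1ℚ 0<1))
    (y≃Σcv j 1ℚ 0<1)

-- Separation of lattice points after scaling.

module _ {s y′ x y w a X M : ℚ} (0<s : 0ℚ ℚ.< s) (sx≡a : s ℚ.* (x ℚ.+ w) ≡ a)
         (s-small : s ℚ.* (1ℚ ℚ.+ (M ℚ.+ X)) ℚ.< ½) where

  -- Split z - a into z - sy′, below 1/2 in absolute value, and s((y′ - (y + w)) + (y - x)), at most
  -- s(1 + M + X) < 1/2.
  lattice-separated : ∀ z → ∣ z ℚ.- s ℚ.* y′ ∣ ℚ.< ½ → ∣ y′ ℚ.- (y ℚ.+ w) ∣ ℚ.< 1ℚ →
    ∣ y ∣ ℚ.≤ M → ∣ x ∣ ℚ.≤ X → ∣ z ℚ.- a ∣ ℚ.< 1ℚ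
  lattice-separated z z≈sy′ y′≈y+w y≤M x≤X = begin-strict
    ∣ z ℚ.- a ∣
      ≡⟨ cong (λ q → ∣ z ℚ.- q ∣) sx≡a ⟨
    ∣ z ℚ.- s ℚ.* (x ℚ.+ w) ∣
      ≡⟨ cong ∣_∣ (split z s y′ y x w) ⟩
    ∣ (z ℚ.- s ℚ.* y′) ℚ.+ s ℚ.* ((y′ ℚ.- (y ℚ.+ w)) ℚ.+ (y ℚ.- x)) ∣
      ≤⟨ ℚₚ.∣p+q∣≤∣p∣+∣q∣ (z ℚ.- s ℚ.* y′) _ ⟩
    ∣ z ℚ.- s ℚ.* y′ ∣ ℚ.+ ∣ s ℚ.* ((y′ ℚ.- (y ℚ.+ w)) ℚ.+ (y ℚ.- x)) ∣
      <⟨ ℚₚ.+-mono-<-≤ z≈sy′ (begin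
        ∣ s ℚ.* ((y′ ℚ.- (y ℚ.+ w)) ℚ.+ (y ℚ.- x)) ∣
          ≡⟨ ℚₚ.∣p*q∣≡∣p∣*∣q∣ s ((y′ ℚ.- (y ℚ.+ w)) ℚ.+ (y ℚ.- x)) ⟩
        ∣ s ∣ ℚ.* ∣ (y′ ℚ.- (y ℚ.+ w)) ℚ.+ (y ℚ.- x) ∣
          ≡⟨ cong (ℚ._* ∣ (y′ ℚ.- (y ℚ.+ w)) ℚ.+ (y ℚ.- x) ∣) (ℚₚ.0≤p⇒∣p∣≡p (ℚₚ.<⇒≤ 0<s)) ⟩
        s ℚ.* ∣ (y′ ℚ.- (y ℚ.+ w)) ℚ.+ (y ℚ.- x) ∣
          ≤⟨ ℚₚ.*-monoˡ-≤-nonNeg s {{ℚ.nonNegative (ℚₚ.<⇒≤ 0<s)}}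
               (ℚₚ.≤-trans (ℚₚ.∣p+q∣≤∣p∣+∣q∣ (y′ ℚ.- (y ℚ.+ w)) (y ℚ.- x))
                 (ℚₚ.+-mono-≤ (ℚₚ.<⇒≤ y′≈y+w)
                   (ℚₚ.≤-trans (ℚₚ.∣p-q∣≤∣p∣+∣q∣ y x) (ℚₚ.+-mono-≤ y≤M x≤X)))) ⟩
        s ℚ.* (1ℚ ℚ.+ (M ℚ.+ X)) ∎) ⟩
    ½ ℚ.+ s ℚ.* (1ℚ ℚ.+ (M ℚ.+ X))
      <⟨ ℚₚ.+-monoʳ-< ½ s-small ⟩
    ½ ℚ.+ ½ ≡⟨⟩
    1ℚ ∎
    where
    open ℚₚ.≤-Reasoning
    open +-*-Solver
    split : ∀ z s y′ y x w → z ℚ.- s ℚ.* (x ℚ.+ w) ≡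
      (z ℚ.- s ℚ.* y′) ℚ.+ s ℚ.* ((y′ ℚ.- (y ℚ.+ w)) ℚ.+ (y ℚ.- x))
    split = solve 6 (λ z s y′ y x w → z :- s :* (x :+ w) :=
      (z :- s :* y′) :+ s :* ((y′ :- (y :+ w)) :+ (y :- x))) refl

-- With t = 1/s and a = s(x + w), the difference x - y equals t(a - sy′) + (y′ - (y + w)), a sum of
-- two null sequences.
dilate-translate-cancel : ∀ {s t : ℚ} {x w a : ℚ} (y y′ : ℝ) → t ℚ.* s ≡ 1ℚ → s ℚ.* (x ℚ.+ w) ≡ a →
  fromℚ a ≃ fromℚ s * y′ → y′ ≃ y + fromℚ w → fromℚ x ≃ y
dilate-translate-cancel {s} {t} {x} {w} {a} y y′ ts≡1 sx≡a a≃sy′ y′≃y+w =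
  null-ext (λ n → simplify (seq y n) (seq y′ n))
    (null-+ (null-* (seq-bounded (fromℚ t)) a≃sy′) y′≃y+w)
  where
  open ≡-Reasoning
  open +-*-Solver
  factor : ∀ t s x w y′ y → t ℚ.* (s ℚ.* (x ℚ.+ w) ℚ.- s ℚ.* y′) ℚ.+ (y′ ℚ.- (y ℚ.+ w)) ≡
    t ℚ.* s ℚ.* (x ℚ.+ w ℚ.- y′) ℚ.+ (y′ ℚ.- (y ℚ.+ w))
  factor = solve 6 (λ t s x w y′ y → t :* (s :* (x :+ w) :- s :* y′) :+ (y′ :- (y :+ w)) :=
    t :* s :* (x :+ w :- y′) :+ (y′ :- (y :+ w))) refl
  cancel : ∀ x w y′ y → 1ℚ ℚ.* (x ℚ.+ w ℚ.- y′) ℚ.+ (y′ ℚ.- (y ℚ.+ w)) ≡ x ℚ.- y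
  cancel = solve 4 (λ x w y′ y →
    con 1ℚ :* (x :+ w :- y′) :+ (y′ :- (y :+ w)) := x :- y) refl
  simplify : ∀ y y′ → t ℚ.* (a ℚ.- s ℚ.* y′) ℚ.+ (y′ ℚ.- (y ℚ.+ w)) ≡ x ℚ.- y
  simplify y y′ = begin
    t ℚ.* (a ℚ.- s ℚ.* y′) ℚ.+ (y′ ℚ.- (y ℚ.+ w))
      ≡⟨ cong (λ b → t ℚ.* (b ℚ.- s ℚ.* y′) ℚ.+ (y′ ℚ.- (y ℚ.+ w))) sx≡a ⟨
    t ℚ.* (s ℚ.* (x ℚ.+ w) ℚ.- s ℚ.* y′) ℚ.+ (y′ ℚ.- (y ℚ.+ w))
      ≡⟨ factor t s x w y′ y ⟩
    t ℚ.* s ℚ.* (x ℚ.+ w ℚ.- y′) ℚ.+ (y′ ℚ.- (y ℚ.+ w))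
      ≡⟨ cong (λ b → b ℚ.* (x ℚ.+ w ℚ.- y′) ℚ.+ (y′ ℚ.- (y ℚ.+ w))) ts≡1 ⟩
    1ℚ ℚ.* (x ℚ.+ w ℚ.- y′) ℚ.+ (y′ ℚ.- (y ℚ.+ w))
      ≡⟨ cancel x w y′ y ⟩
    x ℚ.- y ∎

lookup-injective : ∀ {A : Set} {d} (u v : Vec A d) → (∀ j → lookup u j ≡ lookup v j) → u ≡ v
lookup-injective u v u≗v =
  trans (sym (tabulate∘lookup u)) (trans (tabulate-cong u≗v) (tabulate∘lookup v))

module _ {d} {s X M : ℚ} {x : Vector ℚ d} {w a : Vec ℤ d} (0<s : 0ℚ ℚ.< s)
         (sx≡a : ∀ j → s ℚ.* (x j ℚ.+ ι (lookup w j)) ≡ ι (lookup a j))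
         (s-small : s ℚ.* (1ℚ ℚ.+ (M ℚ.+ X)) ℚ.< ½) (x≤X : ∀ j → ∣ x j ∣ ℚ.≤ X)
         {Y : Pred (ℝ^ d) 0ℓ} where

  lattice-point-unique : Y ⊆ BoundedBy M → ∀ z →
    dilate (fromℚ s) (translate Y w) (embed z) → z ≡ a
  lattice-point-unique Y≤M z (y′ , (y , y∈Y , y′≃y+w) , z≃sy′) = lookup-injective z a λ j →
    -- The estimate for the integers does not mention the index, so a single index at which all
    -- approximations hold is enough.
    ∣ιm-ιn∣<1⇒m≡n {lookup z j} {lookup a j} (ev-now (ev-zip
      (λ n (z≈sy′ , y′≈y+w) y≤M → lattice-separated {y = seq (y j) n} {w = ι (lookup w j)}
         0<s (sx≡a j) s-small (ι (lookup z j)) z≈sy′ y′≈y+w y≤M (x≤X j))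
      (ev-zip (λ _ → _,_) (z≃sy′ j ½ 0<½) (y′≃y+w j 1ℚ 0<1))
      (Y≤M {y} y∈Y j)))

  -- The conclusion names a point y equal to x up to `_≃_`, since `Y` need not respect that
  -- equality.
  lattice-point⇒member : dilate (fromℚ s) (translate Y w) (embed a) →
    ∃[ y ] (Y y × (∀ j → fromℚ (x j) ≃ y j))
  lattice-point⇒member (y′ , (y , y∈Y , y′≃y+w) , a≃sy′)
    with t , _ , ts≡1 ← inverse s 0<s =
    y , y∈Y , λ j → dilate-translate-cancel {s} {t} {x j} (y j) (y′ j) ts≡1 (sx≡a j) (a≃sy′ j) (y′≃y+w j)

  member⇒lattice-point : Y (fromℚ ∘ x) → dilate (fromℚ s) (translate Y w) (embed a)
  member⇒lattice-point x∈Y =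
    (λ j → fromℚ (x j) + embed w j) ,
    (fromℚ ∘ x , x∈Y , λ j → ≡⇒≃ (fromℚ (x j) + embed w j) (fromℚ (x j) + embed w j) (λ _ → refl)) ,
    λ j → ≡⇒≃ (embed a j) (fromℚ s * (fromℚ (x j) + embed w j)) (λ _ → sym (sx≡a j))

  member⇒Ehrhart-1 : Y ⊆ BoundedBy M → Y (fromℚ ∘ x) → Ehrhart (translate Y w) (fromℚ s) 1
  member⇒Ehrhart-1 Y≤M x∈Y = a ∷ [] , [] ∷ [] ,
    (λ z → mk⇔ (λ { (here refl) → member⇒lattice-point x∈Y })
               (λ z∈sY → here (lattice-point-unique Y≤M z z∈sY))) ,
    refl

  -- The count does not say which lattice point z is counted; boundedness of `Y` identifies z with
  -- a.
  Ehrhart-1⇒member : Y ⊆ BoundedBy M → Ehrhart (translate Y w) (fromℚ s) 1 →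
    ∃[ y ] (Y y × (∀ j → fromℚ (x j) ≃ y j))
  Ehrhart-1⇒member Y≤M (z ∷ [] , _ , ∈⇔ , refl) =
    lattice-point⇒member (subst (λ z → dilate (fromℚ s) (translate Y w) (embed z))
      (lattice-point-unique Y≤M z z∈sY) z∈sY)
    where z∈sY = Equivalence.to (∈⇔ z) (here refl)

-- Inclusion and equality of the polytopes.

0<fromℚ : ∀ {s} → 0ℚ ℚ.< s → 0ℝ < fromℚ s
-- `_<_` asks for a gap strictly below s, hence density.
0<fromℚ {s} 0<s = let q , 0<q , q<s = ℚₚ.<-dense 0<s in
  q , 0<q , 0 , λ _ _ → subst (ℚ._< s) (sym (ℚₚ.+-identityˡ q)) q<s

-- By convexity it is enough to place each generator v i of P in Q, and the scaling argument applies
-- to every generator, extreme or not.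
Ehrhart-1⇒⊆ : ∀ {d} (P Q : Pred (ℝ^ d) 0ℓ) → IsRationalPolytope P → IsRationalPolytope Q →
  ((w : Vec ℤ d) (s : ℝ) → 0ℝ < s →
    Ehrhart (translate P w) s 1 → Ehrhart (translate Q w) s 1) →
  P ⊆ Q
Ehrhart-1⇒⊆ {d} P Q (k , v , P⊆v , v⊆P) (l , u , Q⊆u , u⊆Q) P⇒Q {p} p∈P =
  u⊆Q (convexHull-⊆ v′ u′ vertex∈u {p} (P⊆v p∈P))
  where
  v′ : Vector (ℝ^ d) k
  v′ i j = fromℚ (v i j)
  u′ : Vector (ℝ^ d) l
  u′ i j = fromℚ (u i j)
  vertex∈u : ∀ i → convexHull u′ (v′ i)
  vertex∈u i =
    let X , x≤X = upperBound (λ j → ∣ v i j ∣)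
        MP , v≤MP = convexHull-bounded v
        MQ , u≤MQ = convexHull-bounded u
        M = MP ℚ.⊔ MQ
        -- The radius adds the bound M for points of P and Q, the bound X for the vertex, and 1 for
        -- the approximation in the translate. M serves both polytopes because s and w are shared.
        s , 0<s , s-small , w , a , sx≡a = scaleToLattice (v i) (1ℚ ℚ.+ (M ℚ.+ X))
        P≤M : P ⊆ BoundedBy M
        P≤M = λ {y} y∈P j → ev-map (λ n y≤ → ℚₚ.≤-trans y≤ (ℚₚ.p≤p⊔q MP MQ)) (v≤MP {y} (P⊆v y∈P) j)
        Q≤M : Q ⊆ BoundedBy M
        Q≤M = λ {y} y∈Q j → ev-map (λ n y≤ → ℚₚ.≤-trans y≤ (ℚₚ.p≤q⊔p MP MQ)) (u≤MQ {y} (Q⊆u y∈Q) j)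
        y , y∈Q , x≃y = Ehrhart-1⇒member {x = v i} {w = w} {a = a} 0<s sx≡a s-small x≤X Q≤M
          (P⇒Q w (fromℚ s) (0<fromℚ 0<s)
            (member⇒Ehrhart-1 {x = v i} {w = w} {a = a} 0<s sx≡a s-small x≤X P≤M
              (v⊆P (vertex∈convexHull v′ i))))
    in convexHull-resp-≃ u′ y (v′ i) x≃y (Q⊆u y∈Q)

theorem2 : (d : ℕ) (P Q : Pred (ℝ^ d) 0ℓ) →
    IsRationalPolytope P → IsRationalPolytope Q →
    ((w : Vec ℤ d) (s : ℝ) → 0ℝ < s →
    (n : ℕ) → Ehrhart (translate P w) s n ⇔ Ehrhart (translate Q w) s n) →
    P ≐ Q
theorem2 d P Q rP rQ L≡ =
  Ehrhart-1⇒⊆ P Q rP rQ (λ w s 0<s → Equivalence.to (L≡ w s 0<s 1)) ,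
  Ehrhart-1⇒⊆ Q P rQ rP (λ w s 0<s → Equivalence.from (L≡ w s 0<s 1))
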